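{- For every positive integer $n$, \[ \overline{M}(n)=\sum_{d\mid n}\varphi(d)\sum_{\substack{\delta\mid n\\ \gcd(\delta,d)=1}}\mu(\delta)\sum_{\substack{1\le j\le n/\delta\\ \delta j\equiv 1 \ (\mathrm{mod}\ d)}} f\!\left(\left\lfloor \frac{n}{j\delta}\right\rfloor\right), \] where $d$ and $\delta$ run over the positive divisors of $n$, and for $d=1$ the congruence condition is vacuous.
   Context: For a nonempty finite set $A$ of positive integers, $(A)$ denotes the greatest common divisor of the elements of $A$. $\varphi$ is Euler's totient function and $\mu$ is the Möbius function. For $m\in\mathbb{N}$, $f(m)$ is the number of nonempty subsets $A\subseteq\{1,2,\ldots,m\}$ with $(A)=1$ (equivalently $f(m)=\sum_{d=1}^m\mu(d)(2^{\lfloor m/d\rfloor}-1)$). Define \[ \overline{M}(n)=\sum_{\substack{\emptyset\ne A\subseteq\{1,\ldots,n\}\\ \gcd((A),n)=1}}\gcd((A)-1,n), \] the sum over all nonempty subsets $A$ of $\{1,\ldots,n\}$ with $\gcd((A),n)=1$, with the convention $\gcd(0,n)=n$. -}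

module Defs where

open import Data.Bool.Base using (if_then_else_)
open import Data.Fin.Base using (toℕ)
open import Data.Fin.Subset using (Subset; inside; outside)
open import Data.Fin.Subset.Properties using (_∈?_; nonempty?)
open import Data.Integer.Base as ℤ using (ℤ; 0ℤ; -1ℤ)
open import Data.List.Base using (List; []; _∷_; _++_; map; filter; foldr; length; allFin; upTo)
open import Data.List.Relation.Unary.Any using (any?)
open import Data.Nat.Base using (ℕ; zero; suc; _*_; _∸_; ∣_-_∣; NonZero)
open import Data.Nat.Divisibility using (_∣_; _∣?_)
open import Data.Nat.GCD using (gcd)
open import Data.Nat.ListAction using (sum)
open import Data.Nat.Primality using (prime?)
open import Data.Nat.Properties using (_≟_)
open import Data.Vec.Base using ([]; _∷_)
open import Function.Base using (_∘_)
open import Relation.Nullary.Decidable using (Dec; does; _×-dec_)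

-- ∑ n P? f is the sum of f k over those 1 ≤ k ≤ n that satisfy P.
∑ : (n : ℕ) {P : ℕ → Set} → ((k : ℕ) → Dec (P k)) → ((k : ℕ) → .{{NonZero k}} → ℤ) → ℤ
∑ zero    P? f = 0ℤ
∑ (suc n) P? f = ∑ n P? f ℤ.+ (if does (P? (suc n)) then f (suc n) else 0ℤ)

[1⋯_] : ℕ → List ℕ
[1⋯ n ] = map suc (upTo n)

φ : ℕ → ℕ
φ n = length (filter (λ k → gcd k n ≟ 1) [1⋯ n ])

primeDivisors : ℕ → List ℕ
primeDivisors n = filter (λ p → prime? p ×-dec p ∣? n) [1⋯ n ]

-- 0 if some prime square divides n, and otherwise (-1) to the number of
-- primes dividing n.  Only meaningful for n ≥ 1.
μ : ℕ → ℤ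
μ n = if does (any? (λ p → p * p ∣? n) (primeDivisors n))
        then 0ℤ
        else -1ℤ ℤ.^ length (primeDivisors n)

infix 4 _≡_[mod_] _≡?_[mod_]

_≡_[mod_] : ℕ → ℕ → ℕ → Set
a ≡ b [mod d ] = d ∣ ∣ a - b ∣

_≡?_[mod_] : (a b d : ℕ) → Dec (a ≡ b [mod d ])
a ≡? b [mod d ] = d ∣? ∣ a - b ∣

subsets : (n : ℕ) → List (Subset n)
subsets zero    = [] ∷ []
subsets (suc n) = map (outside ∷_) (subsets n) ++ map (inside ∷_) (subsets n)

-- A : Subset n is read as a subset of {1, …, n}: the index i : Fin n stands
-- for the integer toℕ i + 1.
elements : {n : ℕ} → Subset n → List ℕ
elements {n} A = map (suc ∘ toℕ) (filter (_∈? A) (allFin n))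

gcdSet : {n : ℕ} → Subset n → ℕ
gcdSet A = foldr gcd 0 (elements A)

f : ℕ → ℕ
f m = length (filter (λ A → nonempty? A ×-dec gcdSet A ≟ 1) (subsets m))

-- For nonempty A the truncated subtraction is exact, since gcdSet A ≥ 1.
-- The library's gcd satisfies gcd 0 n ≡ n.
M̄ : ℕ → ℕ
M̄ n = sum (map (λ A → gcd (gcdSet A ∸ 1) n)
               (filter (λ A → nonempty? A ×-dec gcd (gcdSet A) n ≟ 1) (subsets n)))

{-# OPTIONS --safe #-}

-- Grouping the subsets A by g = (A) gives M̄ n = Σ_g [gcd g n = 1] gcd (g − 1, n) f ⌊n/g⌋, since
-- dividing by g maps the subsets of {1, …, n} with gcd g onto the subsets of {1, …, ⌊n/g⌋} with
-- gcd 1.  Expand gcd (g − 1, n) = Σ φ d over d ∣ n, d ∣ g − 1 and [gcd g n = 1] = Σ μ δ over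
-- δ ∣ n, δ ∣ g, exchange the sums, and write g = δ j; the condition gcd δ d = 1 is then implied
-- by δ j ≡ 1 mod d.
module Submission where

open import Defs
open import Data.Bool.Base using (true; false; if_then_else_)
open import Data.Fin.Base as Fin using (Fin; toℕ)
open import Data.Fin.Subset using (Subset; inside; outside; Nonempty)
open import Data.Fin.Subset.Properties using (_∈?_; nonempty?)
open import Data.Integer.Base as ℤ using (ℤ; +_; 0ℤ; 1ℤ; -1ℤ)
import Data.Integer.Properties as ℤ
open import Data.Integer.Tactic.RingSolver using (solve-∀)
open import Data.List.Base
  using (List; []; _∷_; _++_; _∷ʳ_; map; filter; foldr; length; allFin; tabulate; upTo)
open import Data.List.Membership.Propositional using (_∈_; find; lose)
open import Data.List.Membership.Propositional.Properties using (∈-filter⁺; ∈-filter⁻; ∈-map⁺; ∈-upTo⁺)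
open import Data.List.Properties using (map-tabulate; map-∘; map-cong; map-++; upTo-∷ʳ)
open import Data.List.Relation.Unary.All using (_∷_)
open import Data.List.Relation.Unary.Any using (Any; any?)
open import Data.Nat.Base
  using (ℕ; zero; suc; _+_; _*_; _/_; _%_; _∸_; _≤_; _<_; z≤n; s≤s; NonZero; NonTrivial;
    nonTrivial⇒nonZero; nonTrivial⇒≢1; 2+; ≢-nonZero; ≢-nonZero⁻¹)
open import Data.Nat.Coprimality using (Coprime; coprime-divisor; coprime⇒gcd≡1)
open import Data.Nat.Divisibility
open import Data.Nat.DivMod using (m≡m%n+[m/n]*n; m%n<n; m*n/n≡m)
open import Data.Nat.GCD
open import Data.Nat.ListAction using (sum; product)
open import Data.Nat.Primality
  using (Prime; prime?; prime⇒irreducible; prime⇒nonZero; euclidsLemma; ¬prime[1])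
open import Data.Nat.Primality.Factorisation using (factorise)
open import Data.Nat.Properties
  using (_≟_; m*n≢0; ≤-refl; ≤-trans; m≤n⇒m≤1+n; n≤1+n; 1+n≢0; m≤n+m; m∸n+n≡m; <⇒≢; >⇒≢;
    +-comm; +-identityʳ; +-suc; *-comm; *-cancelʳ-≡; ∣-∣-identityʳ; m*n≢0⇒m≢0; m*n≢0⇒n≢0;
    *-identityʳ; *-zeroʳ; *-cancelˡ-≡)
open import Data.Product.Base using (∃; _×_; _,_; proj₁; proj₂)
open import Data.Sum.Base using (inj₁; inj₂; [_,_]′)
open import Data.Vec.Base using ([]; _∷_; here; there)
open import Function.Base using (_∘_; id)
open import Function.Bundles using (mk⇔)
open import Relation.Binary.PropositionalEquality
  using (_≡_; _≢_; refl; sym; trans; cong; cong₂; subst; module ≡-Reasoning)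
open import Relation.Nullary.Decidable
  using (Dec; yes; no; does; _×-dec_; ¬?; decidable-stable; dec-true; does-⇔)
open import Relation.Nullary.Negation using (¬_; contradiction)

open ≡-Reasoning

-- Conditions of summation become factors `𝟙`, and all three variables run over the full range up to
-- n. Every exchange of sums is then a swap over a rectangle, and ranges such as j ≤ n/δ are
-- recovered from the support of the summand. The correspondence between subsets under division by g
-- is not built as a bijection. Since the summands depend on A only through its gcd, sums over
-- subsets are replaced by the recursion `gcdSum`, which adjoins the largest element last. There,
-- division by g is an induction on the bound. The empty set has gcd 0, so nonemptiness also becomes
-- a condition on the gcd alone. As `μ` is defined by counting primes, its divisor sum is obtained
-- by cancellation at a single prime factor instead of from multiplicativity.

private
  variable
    A B : Set
    P Q : Set
    x y : ℤ
    F G : ℕ → ℤ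

-- Indicators

𝟙 : Dec P → ℤ
𝟙 p = if does p then 1ℤ else 0ℤ

𝟙-true : (p : Dec P) → P → 𝟙 p ≡ 1ℤ
𝟙-true (yes _) _ = refl
𝟙-true (no ¬h) h = contradiction h ¬h

𝟙-false : (p : Dec P) → ¬ P → 𝟙 p ≡ 0ℤ
𝟙-false (yes h) ¬h = contradiction h ¬h
𝟙-false (no _)  _  = refl

𝟙-cong : (p : Dec P) (q : Dec Q) → (P → Q) → (Q → P) → 𝟙 p ≡ 𝟙 q
𝟙-cong (yes h) q to from = sym (𝟙-true q (to h))
𝟙-cong (no ¬h) q to from = sym (𝟙-false q (¬h ∘ from))

𝟙-× : (p : Dec P) (q : Dec Q) → 𝟙 (p ×-dec q) ≡ 𝟙 p ℤ.* 𝟙 q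
𝟙-× (yes _) (yes _) = refl
𝟙-× (yes _) (no _)  = refl
𝟙-× (no _)  (yes _) = refl
𝟙-× (no _)  (no _)  = refl

𝟙-*-cong : (p : Dec P) → (P → x ≡ y) → 𝟙 p ℤ.* x ≡ 𝟙 p ℤ.* y
𝟙-*-cong (yes h) eq = cong (1ℤ ℤ.*_) (eq h)
𝟙-*-cong (no _)  eq = refl

𝟙-*-true : (p : Dec P) → P → 𝟙 p ℤ.* x ≡ x
𝟙-*-true p h = trans (cong (ℤ._* _) (𝟙-true p h)) (ℤ.*-identityˡ _)

if≡𝟙* : (p : Dec P) (x : ℤ) → (if does p then x else 0ℤ) ≡ 𝟙 p ℤ.* x
if≡𝟙* (yes _) x = sym (ℤ.*-identityˡ x)
if≡𝟙* (no _)  x = refl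

-- Sums over {1, …, n}

-- In contrast to `∑`, the summand is total and carries no predicate, so that sums can be swapped
-- and reindexed freely.
Sum : ℕ → (ℕ → ℤ) → ℤ
Sum zero    F = 0ℤ
Sum (suc n) F = Sum n F ℤ.+ F (suc n)

Sum-cong : ∀ n → (∀ k → .{{NonZero k}} → k ≤ n → F k ≡ G k) → Sum n F ≡ Sum n G
Sum-cong zero    eq = refl
Sum-cong (suc n) eq = cong₂ ℤ._+_ (Sum-cong n λ k k≤n → eq k (m≤n⇒m≤1+n k≤n)) (eq (suc n) ≤-refl)

Sum-zero : ∀ n → (∀ k → .{{NonZero k}} → k ≤ n → F k ≡ 0ℤ) → Sum n F ≡ 0ℤ
Sum-zero zero    eq = refl
Sum-zero (suc n) eq = cong₂ ℤ._+_ (Sum-zero n λ k k≤n → eq k (m≤n⇒m≤1+n k≤n)) (eq (suc n) ≤-refl)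

+-interchange : ∀ a b c d → (a ℤ.+ b) ℤ.+ (c ℤ.+ d) ≡ (a ℤ.+ c) ℤ.+ (b ℤ.+ d)
+-interchange = solve-∀

Sum-+ : ∀ n (F G : ℕ → ℤ) → Sum n (λ k → F k ℤ.+ G k) ≡ Sum n F ℤ.+ Sum n G
Sum-+ zero    F G = refl
Sum-+ (suc n) F G = trans (cong₂ ℤ._+_ (Sum-+ n F G) refl) (+-interchange (Sum n F) (Sum n G) _ _)

Sum-*ˡ : ∀ n c (F : ℕ → ℤ) → Sum n (λ k → c ℤ.* F k) ≡ c ℤ.* Sum n F
Sum-*ˡ zero    c F = sym (ℤ.*-zeroʳ c)
Sum-*ˡ (suc n) c F = trans (cong₂ ℤ._+_ (Sum-*ˡ n c F) refl) (sym (ℤ.*-distribˡ-+ c (Sum n F) (F (suc n))))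

Sum-*ʳ : ∀ n c (F : ℕ → ℤ) → Sum n (λ k → F k ℤ.* c) ≡ Sum n F ℤ.* c
Sum-*ʳ n c F = begin
  Sum n (λ k → F k ℤ.* c)  ≡⟨ Sum-cong n (λ k _ → ℤ.*-comm (F k) c) ⟩
  Sum n (λ k → c ℤ.* F k)  ≡⟨ Sum-*ˡ n c F ⟩
  c ℤ.* Sum n F            ≡⟨ ℤ.*-comm c (Sum n F) ⟩
  Sum n F ℤ.* c            ∎

Sum-swap : ∀ m n (H : ℕ → ℕ → ℤ) → Sum m (λ i → Sum n (H i)) ≡ Sum n (λ j → Sum m (λ i → H i j))
Sum-swap zero    n H = sym (Sum-zero n λ _ _ → refl)
Sum-swap (suc m) n H = trans (cong₂ ℤ._+_ (Sum-swap m n H) refl) (sym (Sum-+ n _ _))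

Sum-extend : ∀ m l → (∀ k → m < k → F k ≡ 0ℤ) → Sum (l + m) F ≡ Sum m F
Sum-extend m zero    eq = refl
Sum-extend {F} m (suc l) eq = begin
  Sum (l + m) F ℤ.+ F (suc (l + m))  ≡⟨ cong₂ ℤ._+_ (Sum-extend m l eq) (eq _ (s≤s (m≤n+m m l))) ⟩
  Sum m F ℤ.+ 0ℤ                     ≡⟨ ℤ.+-identityʳ _ ⟩
  Sum m F                            ∎

Sum-truncate : ∀ {m n} → m ≤ n → (∀ k → m < k → F k ≡ 0ℤ) → Sum n F ≡ Sum m F
Sum-truncate {F} {m} {n} m≤n eq =
  trans (cong (λ k → Sum k F) (sym (m∸n+n≡m m≤n))) (Sum-extend m (n ∸ m) eq)

Sum-δ : ∀ n m → .{{NonZero m}} → m ≤ n → (F : ℕ → ℤ) → Sum n (λ k → 𝟙 (m ≟ k) ℤ.* F k) ≡ F m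
Sum-δ n m@(suc m′) m≤n F = begin
  Sum n (λ k → 𝟙 (m ≟ k) ℤ.* F k)
    ≡⟨ Sum-truncate m≤n (λ k m<k → cong (ℤ._* F k) (𝟙-false (m ≟ k) (<⇒≢ m<k))) ⟩
  Sum m′ (λ k → 𝟙 (m ≟ k) ℤ.* F k) ℤ.+ 𝟙 (m ≟ m) ℤ.* F m
    ≡⟨ cong₂ ℤ._+_
         (Sum-zero m′ (λ k k≤m′ → cong (ℤ._* F k) (𝟙-false (m ≟ k) (>⇒≢ (s≤s k≤m′)))))
         (cong (ℤ._* F m) (𝟙-true (m ≟ m) refl)) ⟩
  0ℤ ℤ.+ 1ℤ ℤ.* F m
    ≡⟨ trans (ℤ.+-identityˡ _) (ℤ.*-identityˡ _) ⟩
  F m ∎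

e∤r+qe : ∀ e q r → r < e → .{{NonZero r}} → e ∤ r + q * e
e∤r+qe e q r r<e e∣ = >⇒∤ r<e (∣m+n∣m⇒∣n (subst (e ∣_) (+-comm r (q * e)) e∣) (n∣m*n q))

-- Writing the bound as remainder plus multiple lets the induction strip the last index: it is a
-- non-multiple when the remainder is positive, and otherwise the multiple with quotient `suc q`,
-- below which the remainder restarts at `e`.
Sum-multiples′ : ∀ e → (∀ k → suc e ∤ k → F k ≡ 0ℤ) → ∀ q r → r < suc e →
                 Sum (r + q * suc e) F ≡ Sum q (λ j → F (suc e * j))
Sum-multiples′ e supp zero zero _ = refl
Sum-multiples′ {F} e supp (suc q) zero _ =
  cong₂ ℤ._+_ (Sum-multiples′ e supp q e ≤-refl) (cong F (*-comm (suc q) (suc e)))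
Sum-multiples′ {F} e supp q (suc r) r<e = begin
  Sum (r + q * suc e) F ℤ.+ F (suc r + q * suc e)
    ≡⟨ cong₂ ℤ._+_ (Sum-multiples′ e supp q r (≤-trans (n≤1+n _) r<e)) (supp _ (e∤r+qe (suc e) q (suc r) r<e)) ⟩
  Sum q (λ j → F (suc e * j)) ℤ.+ 0ℤ
    ≡⟨ ℤ.+-identityʳ _ ⟩
  Sum q (λ j → F (suc e * j)) ∎

Sum-multiples : ∀ e n → .{{_ : NonZero e}} → (∀ k → e ∤ k → F k ≡ 0ℤ) →
                Sum n F ≡ Sum (n / e) (λ j → F (e * j))
Sum-multiples {F} e@(suc e′) n supp =
  trans (cong (λ k → Sum k F) (m≡m%n+[m/n]*n n e)) (Sum-multiples′ e′ supp (n / e) (n % e) (m%n<n n e))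

gcd-nonZero : ∀ m n → .{{NonZero n}} → NonZero (gcd m n)
gcd-nonZero m n = ≢-nonZero (gcd[m,n]≢0 m n (inj₂ (≢-nonZero⁻¹ n)))

-- The bridge from the sums of the statement: `g` may divide by its index, whereas `G` is total and
-- needs to agree with it only on the range.
∑≡Sum : ∀ n {P : ℕ → Set} (P? : ∀ k → Dec (P k)) (g : ∀ k → .{{NonZero k}} → ℤ) (G : ℕ → ℤ) →
        (∀ k → .{{_ : NonZero k}} → k ≤ n → 𝟙 (P? k) ℤ.* g k ≡ G k) → ∑ n P? g ≡ Sum n G
∑≡Sum zero    P? g G eq = refl
∑≡Sum (suc n) P? g G eq = cong₂ ℤ._+_
  (∑≡Sum n P? g G λ k k≤n → eq k (m≤n⇒m≤1+n k≤n))
  (trans (if≡𝟙* (P? (suc n)) (g (suc n))) (eq (suc n) ≤-refl))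

-- Sums over lists

sumOver : List A → (A → ℤ) → ℤ
sumOver []       F = 0ℤ
sumOver (x ∷ xs) F = F x ℤ.+ sumOver xs F

sumOver-++ : (xs ys : List A) (F : A → ℤ) → sumOver (xs ++ ys) F ≡ sumOver xs F ℤ.+ sumOver ys F
sumOver-++ []       ys F = sym (ℤ.+-identityˡ _)
sumOver-++ (x ∷ xs) ys F = trans (cong (ℤ._+_ (F x)) (sumOver-++ xs ys F)) (sym (ℤ.+-assoc (F x) _ _))

sumOver-map : (h : A → B) (xs : List A) (F : B → ℤ) → sumOver (map h xs) F ≡ sumOver xs (F ∘ h)
sumOver-map h []       F = refl
sumOver-map h (x ∷ xs) F = cong (ℤ._+_ (F (h x))) (sumOver-map h xs F)

sumOver-cong : (xs : List A) {F G : A → ℤ} → (∀ x → F x ≡ G x) → sumOver xs F ≡ sumOver xs G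
sumOver-cong []       eq = refl
sumOver-cong (x ∷ xs) eq = cong₂ ℤ._+_ (eq x) (sumOver-cong xs eq)

sum-map-filter : {P : A → Set} (P? : ∀ x → Dec (P x)) (h : A → ℕ) (xs : List A) →
                 + sum (map h (filter P? xs)) ≡ sumOver xs (λ x → 𝟙 (P? x) ℤ.* + h x)
sum-map-filter P? h [] = refl
sum-map-filter P? h (x ∷ xs) with P? x
... | yes _ = cong₂ ℤ._+_ (sym (ℤ.*-identityˡ (+ h x))) (sum-map-filter P? h xs)
... | no  _ = trans (sum-map-filter P? h xs) (sym (ℤ.+-identityˡ _))

length-filter : {P : A → Set} (P? : ∀ x → Dec (P x)) (xs : List A) →
                + length (filter P? xs) ≡ sumOver xs (𝟙 ∘ P?)
length-filter P? [] = refl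
length-filter P? (x ∷ xs) with P? x
... | yes _ = cong (ℤ._+_ 1ℤ) (length-filter P? xs)
... | no  _ = trans (length-filter P? xs) (sym (ℤ.+-identityˡ _))

sumOver-[1⋯] : ∀ n (F : ℕ → ℤ) → sumOver [1⋯ n ] F ≡ Sum n F
sumOver-[1⋯] zero    F = refl
sumOver-[1⋯] (suc n) F = begin
  sumOver (map suc (upTo (suc n))) F           ≡⟨ cong (λ xs → sumOver (map suc xs) F) (upTo-∷ʳ n) ⟨
  sumOver (map suc (upTo n ∷ʳ n)) F            ≡⟨ cong (λ xs → sumOver xs F) (map-++ suc (upTo n) (n ∷ [])) ⟩
  sumOver ([1⋯ n ] ++ suc n ∷ []) F            ≡⟨ sumOver-++ [1⋯ n ] (suc n ∷ []) F ⟩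
  sumOver [1⋯ n ] F ℤ.+ (F (suc n) ℤ.+ 0ℤ)     ≡⟨ cong₂ ℤ._+_ (sumOver-[1⋯] n F) (ℤ.+-identityʳ _) ⟩
  Sum n F ℤ.+ F (suc n)                        ∎

count-[1⋯] : {P : ℕ → Set} (P? : ∀ k → Dec (P k)) → ∀ n → + length (filter P? [1⋯ n ]) ≡ Sum n (𝟙 ∘ P?)
count-[1⋯] P? n = trans (length-filter P? [1⋯ n ]) (sumOver-[1⋯] n (𝟙 ∘ P?))

-- Sums over subsets of functions of the gcd

-- gcdSum n F is the sum of F (gcd A) over all A ⊆ {1, …, n}, where gcd ∅ = 0.
gcdSum : ℕ → (ℕ → ℤ) → ℤ
gcdSum zero    F = F 0
gcdSum (suc n) F = gcdSum n F ℤ.+ gcdSum n (λ x → F (gcd (suc n) x))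

-- A gcd with an adjoined element divides that element, so no value exceeds n. This bound is what
-- lets `gcdSum-partition` stop at n.
gcdSum-cong : ∀ n → (∀ x → x ≤ n → F x ≡ G x) → gcdSum n F ≡ gcdSum n G
gcdSum-cong zero    eq = eq 0 z≤n
gcdSum-cong (suc n) eq = cong₂ ℤ._+_
  (gcdSum-cong n λ x x≤n → eq x (m≤n⇒m≤1+n x≤n))
  (gcdSum-cong n λ x x≤n → eq (gcd (suc n) x) (∣⇒≤ (gcd[m,n]∣m (suc n) x)))

gcdSum-zero : ∀ n → (∀ x → F x ≡ 0ℤ) → gcdSum n F ≡ 0ℤ
gcdSum-zero zero    eq = eq 0
gcdSum-zero (suc n) eq = cong₂ ℤ._+_ (gcdSum-zero n eq) (gcdSum-zero n λ x → eq (gcd (suc n) x))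

gcdSum-+ : ∀ n (F G : ℕ → ℤ) → gcdSum n (λ x → F x ℤ.+ G x) ≡ gcdSum n F ℤ.+ gcdSum n G
gcdSum-+ zero    F G = refl
gcdSum-+ (suc n) F G =
  trans (cong₂ ℤ._+_ (gcdSum-+ n F G) (gcdSum-+ n _ _)) (+-interchange (gcdSum n F) (gcdSum n G) _ _)

gcdSum-*ˡ : ∀ n c (F : ℕ → ℤ) → gcdSum n (λ x → c ℤ.* F x) ≡ c ℤ.* gcdSum n F
gcdSum-*ˡ zero    c F = refl
gcdSum-*ˡ (suc n) c F =
  trans (cong₂ ℤ._+_ (gcdSum-*ˡ n c F) (gcdSum-*ˡ n c _)) (sym (ℤ.*-distribˡ-+ c (gcdSum n F) _))

gcdSum-Sum : ∀ n m (H : ℕ → ℕ → ℤ) →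
             gcdSum n (λ x → Sum m (λ g → H g x)) ≡ Sum m (λ g → gcdSum n (H g))
gcdSum-Sum n zero    H = gcdSum-zero n λ _ → refl
gcdSum-Sum n (suc m) H = trans (gcdSum-+ n _ _) (cong₂ ℤ._+_ (gcdSum-Sum n m H) refl)

-- Adjoining the elements of {1, …, r + q e} one at a time, only the multiples
-- of e contribute, and e q′ acts on gcds of multiples of e as q′ does on their quotients.
gcdSum-multiples′ : ∀ e q r → r < suc e → (F : ℕ → ℤ) → (∀ x → suc e ∤ x → F x ≡ 0ℤ) →
                    gcdSum (r + q * suc e) F ≡ gcdSum q (λ x → F (suc e * x))
gcdSum-multiples′ e zero zero _ F supp = cong F (sym (*-zeroʳ e))
gcdSum-multiples′ e (suc q) zero _ F supp = cong₂ ℤ._+_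
  (gcdSum-multiples′ e q e ≤-refl F supp)
  (trans
    -- The function seen after adjoining the new multiple again vanishes off the multiples of
    -- `suc e`, because the gcd divides x.
    (gcdSum-multiples′ e q e ≤-refl _ λ x ∤x →
      supp _ λ ∣gcd → ∤x (∣-trans ∣gcd (gcd[m,n]∣n (suc q * suc e) x)))
    (gcdSum-cong q λ x _ → cong F (trans
      (cong (λ m → gcd m (suc e * x)) (*-comm (suc q) (suc e)))
      (sym (c*gcd[m,n]≡gcd[cm,cn] (suc e) (suc q) x)))))
gcdSum-multiples′ e q (suc r) r<e F supp = begin
  gcdSum (r + q * suc e) F ℤ.+ gcdSum (r + q * suc e) (λ x → F (gcd (suc r + q * suc e) x))
    ≡⟨ cong₂ ℤ._+_
         (gcdSum-multiples′ e q r (≤-trans (n≤1+n _) r<e) F supp)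
         (gcdSum-zero (r + q * suc e) λ x →
           supp _ λ ∣gcd → e∤r+qe (suc e) q (suc r) r<e (∣-trans ∣gcd (gcd[m,n]∣m _ x))) ⟩
  gcdSum q (λ x → F (suc e * x)) ℤ.+ 0ℤ
    ≡⟨ ℤ.+-identityʳ _ ⟩
  gcdSum q (λ x → F (suc e * x)) ∎

gcdSum-multiples : ∀ e n → .{{_ : NonZero e}} → (F : ℕ → ℤ) → (∀ x → e ∤ x → F x ≡ 0ℤ) →
                   gcdSum n F ≡ gcdSum (n / e) (λ x → F (e * x))
gcdSum-multiples e@(suc e′) n F supp =
  trans (cong (λ k → gcdSum k F) (m≡m%n+[m/n]*n n e)) (gcdSum-multiples′ e′ (n / e) (n % e) (m%n<n n e) F supp)

-- The indicator of x = g is supported on multiples of g, and g x = g means x = 1.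
gcdSum-𝟙 : ∀ g n → .{{_ : NonZero g}} → gcdSum n (λ x → 𝟙 (x ≟ g)) ≡ gcdSum (n / g) (λ x → 𝟙 (x ≟ 1))
gcdSum-𝟙 g n = trans
  (gcdSum-multiples g n _ λ x g∤x → 𝟙-false (x ≟ g) λ x≡g → g∤x (∣-reflexive (sym x≡g)))
  (gcdSum-cong (n / g) λ x _ → 𝟙-cong (g * x ≟ g) (x ≟ 1)
    (λ gx≡g → *-cancelˡ-≡ x 1 g (trans gx≡g (sym (*-identityʳ g))))
    (λ x≡1 → trans (cong (g *_) x≡1) (*-identityʳ g)))

-- The empty set has gcd 0, which lies outside the range 1 ≤ g ≤ n; the hypothesis at 0 accounts for
-- it.
gcdSum-partition : ∀ n (F : ℕ → ℤ) → F 0 ≡ 0ℤ →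
                   gcdSum n F ≡ Sum n (λ g → F g ℤ.* gcdSum n (λ x → 𝟙 (x ≟ g)))
gcdSum-partition n F F0≡0 = begin
  gcdSum n F
    ≡⟨ gcdSum-cong n byValue ⟩
  gcdSum n (λ x → Sum n (λ g → F g ℤ.* 𝟙 (x ≟ g)))
    ≡⟨ gcdSum-Sum n n (λ g x → F g ℤ.* 𝟙 (x ≟ g)) ⟩
  Sum n (λ g → gcdSum n (λ x → F g ℤ.* 𝟙 (x ≟ g)))
    ≡⟨ Sum-cong n (λ g _ → gcdSum-*ˡ n (F g) (λ x → 𝟙 (x ≟ g))) ⟩
  Sum n (λ g → F g ℤ.* gcdSum n (λ x → 𝟙 (x ≟ g))) ∎
  where
  byValue : ∀ x → x ≤ n → F x ≡ Sum n (λ g → F g ℤ.* 𝟙 (x ≟ g))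
  byValue zero _ = trans F0≡0 (sym (Sum-zero n λ { (suc g) _ → ℤ.*-zeroʳ (F (suc g)) }))
  byValue x@(suc _) x≤n = sym (trans
    (Sum-cong n λ g _ → ℤ.*-comm (F g) (𝟙 (x ≟ g)))
    (Sum-δ n x x≤n F))

-- The gcd of A, read as a subset of {k + 1, …, k + n}.
gcdFrom : ∀ {n} → ℕ → Subset n → ℕ
gcdFrom k []            = 0
gcdFrom k (outside ∷ A) = gcdFrom (suc k) A
gcdFrom k (inside  ∷ A) = gcd (suc k) (gcdFrom (suc k) A)

filter-∈?-map-suc : ∀ {n} b (A : Subset n) (xs : List (Fin n)) →
                    filter (_∈? (b ∷ A)) (map Fin.suc xs) ≡ map Fin.suc (filter (_∈? A) xs)
filter-∈?-map-suc b A [] = refl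
filter-∈?-map-suc b A (x ∷ xs) with x ∈? A
... | yes _ = cong (Fin.suc x ∷_) (filter-∈?-map-suc b A xs)
... | no  _ = filter-∈?-map-suc b A xs

-- The tail of a subset stands for integers starting one later, hence the offset k. The mutual
-- `tail-gcd` treats `tabulate Fin.suc`, which is what `allFin` leaves after its first index.
foldr-gcd≡gcdFrom : ∀ {n} k (A : Subset n) →
  foldr gcd 0 (map (λ i → suc (k + toℕ i)) (filter (_∈? A) (allFin n))) ≡ gcdFrom k A
tail-gcd : ∀ {n} k b (A : Subset n) →
  foldr gcd 0 (map (λ i → suc (k + toℕ i)) (filter (_∈? (b ∷ A)) (tabulate Fin.suc))) ≡ gcdFrom (suc k) A

foldr-gcd≡gcdFrom k []            = refl
foldr-gcd≡gcdFrom k (outside ∷ A) = tail-gcd k outside A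
foldr-gcd≡gcdFrom k (inside  ∷ A) = cong₂ gcd (cong suc (+-identityʳ k)) (tail-gcd k inside A)

tail-gcd {n} k b A = begin
  foldr gcd 0 (map h (filter (_∈? (b ∷ A)) (tabulate Fin.suc)))
    ≡⟨ cong (λ xs → foldr gcd 0 (map h (filter (_∈? (b ∷ A)) xs))) (map-tabulate id Fin.suc) ⟨
  foldr gcd 0 (map h (filter (_∈? (b ∷ A)) (map Fin.suc (allFin n))))
    ≡⟨ cong (λ xs → foldr gcd 0 (map h xs)) (filter-∈?-map-suc b A (allFin n)) ⟩
  foldr gcd 0 (map h (map Fin.suc (filter (_∈? A) (allFin n))))
    ≡⟨ cong (foldr gcd 0) (map-∘ (filter (_∈? A) (allFin n))) ⟨
  foldr gcd 0 (map (h ∘ Fin.suc) (filter (_∈? A) (allFin n)))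
    ≡⟨ cong (foldr gcd 0) (map-cong (λ i → cong suc (+-suc k (toℕ i))) (filter (_∈? A) (allFin n))) ⟩
  foldr gcd 0 (map (λ i → suc (suc k + toℕ i)) (filter (_∈? A) (allFin n)))
    ≡⟨ foldr-gcd≡gcdFrom (suc k) A ⟩
  gcdFrom (suc k) A ∎
  where
  h : Fin (suc n) → ℕ
  h i = suc (k + toℕ i)

gcdFrom-nonempty : ∀ {n} k (A : Subset n) → Nonempty A → gcdFrom k A ≢ 0
gcdFrom-nonempty k (outside ∷ A) (Fin.suc i , there i∈A) = gcdFrom-nonempty (suc k) A (i , i∈A)
gcdFrom-nonempty k (inside  ∷ A) _                       = gcd[m,n]≢0 (suc k) (gcdFrom (suc k) A) (inj₁ 1+n≢0)

gcdFrom-empty : ∀ {n} k (A : Subset n) → ¬ Nonempty A → gcdFrom k A ≡ 0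
gcdFrom-empty k []            _  = refl
gcdFrom-empty k (outside ∷ A) ¬∃ = gcdFrom-empty (suc k) A λ (i , i∈A) → ¬∃ (Fin.suc i , there i∈A)
gcdFrom-empty k (inside  ∷ A) ¬∃ = contradiction (Fin.zero , here) ¬∃

-- With this, the summands of `f` and `M̄` become functions of the gcd alone, as `sumOver-gcdSet`
-- requires.
𝟙-nonempty : ∀ {n} (A : Subset n) → 𝟙 (nonempty? A) ≡ 𝟙 (¬? (gcdSet A ≟ 0))
𝟙-nonempty A = 𝟙-cong (nonempty? A) (¬? (gcdSet A ≟ 0))
  (λ ne gcd≡0 → gcdFrom-nonempty 0 A ne (trans (sym (foldr-gcd≡gcdFrom 0 A)) gcd≡0))
  (λ gcd≢0 → decidable-stable (nonempty? A) λ ¬ne →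
    gcd≢0 (trans (foldr-gcd≡gcdFrom 0 A) (gcdFrom-empty 0 A ¬ne)))

sumOver-subsets-suc : ∀ n (H : Subset (suc n) → ℤ) →
  sumOver (subsets (suc n)) H ≡
  sumOver (subsets n) (H ∘ (outside ∷_)) ℤ.+ sumOver (subsets n) (H ∘ (inside ∷_))
sumOver-subsets-suc n H = trans
  (sumOver-++ (map (outside ∷_) (subsets n)) _ H)
  (cong₂ ℤ._+_ (sumOver-map (outside ∷_) (subsets n) H) (sumOver-map (inside ∷_) (subsets n) H))

gcd-swap : ∀ a b c → gcd a (gcd b c) ≡ gcd b (gcd a c)
gcd-swap a b c = trans (sym (gcd-assoc a b c)) (trans (cong (λ m → gcd m c) (gcd-comm a b)) (gcd-assoc b a c))

-- subsets branches on the smallest element, gcdSum on the largest.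
sumOver-subsets-last : ∀ n k (F : ℕ → ℤ) →
  sumOver (subsets (suc n)) (F ∘ gcdFrom k) ≡
  sumOver (subsets n) (F ∘ gcdFrom k) ℤ.+ sumOver (subsets n) (λ A → F (gcd (suc (n + k)) (gcdFrom k A)))
sumOver-subsets-last zero k F = +-swapʳ (F 0) (F (gcd (suc k) 0))
  where
  +-swapʳ : ∀ a b → a ℤ.+ (b ℤ.+ 0ℤ) ≡ (a ℤ.+ 0ℤ) ℤ.+ (b ℤ.+ 0ℤ)
  +-swapʳ = solve-∀
sumOver-subsets-last (suc n) k F = begin
  sumOver (subsets (2 + n)) (F ∘ gcdFrom k)
    ≡⟨ sumOver-subsets-suc (suc n) _ ⟩
  U (suc n) F ℤ.+ U (suc n) (F ∘ gcd (suc k))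
    ≡⟨ cong₂ ℤ._+_ (sumOver-subsets-last n (suc k) F) (sumOver-subsets-last n (suc k) (F ∘ gcd (suc k))) ⟩
  (U n F ℤ.+ U n (F ∘ gcd (suc (n + suc k)))) ℤ.+
  (U n (F ∘ gcd (suc k)) ℤ.+ U n (F ∘ gcd (suc k) ∘ gcd (suc (n + suc k))))
    -- The four sums record whether the smallest and the largest element are present. Regrouping
    -- makes the largest the outer choice; the two gcds are then commuted to match.
    ≡⟨ +-interchange (U n F) _ _ _ ⟩
  (U n F ℤ.+ U n (F ∘ gcd (suc k))) ℤ.+
  (U n (F ∘ gcd (suc (n + suc k))) ℤ.+ U n (F ∘ gcd (suc k) ∘ gcd (suc (n + suc k))))
    ≡⟨ cong (ℤ._+_ (U n F ℤ.+ U n (F ∘ gcd (suc k)))) (cong₂ ℤ._+_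
         (sumOver-cong (subsets n) λ A → cong (λ m → F (gcd (suc m) (gcdFrom (suc k) A))) (+-suc n k))
         (sumOver-cong (subsets n) λ A → cong F (trans
           (gcd-swap (suc k) (suc (n + suc k)) (gcdFrom (suc k) A))
           (cong (λ m → gcd (suc m) (gcd (suc k) (gcdFrom (suc k) A))) (+-suc n k))))) ⟩
  (U n F ℤ.+ U n (F ∘ gcd (suc k))) ℤ.+
  (U n (F ∘ gcd (suc (suc n + k))) ℤ.+ U n (F ∘ gcd (suc (suc n + k)) ∘ gcd (suc k)))
    ≡⟨ cong₂ ℤ._+_ (sumOver-subsets-suc n _) (sumOver-subsets-suc n _) ⟨
  sumOver (subsets (suc n)) (F ∘ gcdFrom k) ℤ.+
  sumOver (subsets (suc n)) (λ A → F (gcd (suc (suc n + k)) (gcdFrom k A))) ∎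
  where
  U : ∀ m → (ℕ → ℤ) → ℤ
  U m F = sumOver (subsets m) (F ∘ gcdFrom (suc k))

sumOver-gcdFrom : ∀ n (F : ℕ → ℤ) → sumOver (subsets n) (F ∘ gcdFrom 0) ≡ gcdSum n F
sumOver-gcdFrom zero    F = ℤ.+-identityʳ (F 0)
sumOver-gcdFrom (suc n) F = begin
  sumOver (subsets (suc n)) (F ∘ gcdFrom 0)
    ≡⟨ sumOver-subsets-last n 0 F ⟩
  sumOver (subsets n) (F ∘ gcdFrom 0) ℤ.+ sumOver (subsets n) (F ∘ gcd (suc (n + 0)) ∘ gcdFrom 0)
    ≡⟨ cong₂ ℤ._+_ (sumOver-gcdFrom n F) (sumOver-gcdFrom n (F ∘ gcd (suc (n + 0)))) ⟩
  gcdSum n F ℤ.+ gcdSum n (F ∘ gcd (suc (n + 0)))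
    ≡⟨ cong (λ m → gcdSum n F ℤ.+ gcdSum n (F ∘ gcd (suc m))) (+-identityʳ n) ⟩
  gcdSum n F ℤ.+ gcdSum n (F ∘ gcd (suc n)) ∎

sumOver-gcdSet : ∀ n (F : ℕ → ℤ) → sumOver (subsets n) (F ∘ gcdSet) ≡ gcdSum n F
sumOver-gcdSet n F = trans
  (sumOver-cong (subsets n) λ A → cong F (foldr-gcd≡gcdFrom 0 A))
  (sumOver-gcdFrom n F)

f≡gcdSum : ∀ m → + f m ≡ gcdSum m (λ x → 𝟙 (x ≟ 1))
f≡gcdSum m = begin
  + f m
    ≡⟨ length-filter (λ A → nonempty? A ×-dec gcdSet A ≟ 1) (subsets m) ⟩
  sumOver (subsets m) (λ A → 𝟙 (nonempty? A ×-dec gcdSet A ≟ 1))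
    ≡⟨ sumOver-cong (subsets m) (λ A → begin
         𝟙 (nonempty? A ×-dec gcdSet A ≟ 1)             ≡⟨ 𝟙-× (nonempty? A) (gcdSet A ≟ 1) ⟩
         𝟙 (nonempty? A) ℤ.* 𝟙 (gcdSet A ≟ 1)           ≡⟨ cong (ℤ._* 𝟙 (gcdSet A ≟ 1)) (𝟙-nonempty A) ⟩
         𝟙 (¬? (gcdSet A ≟ 0)) ℤ.* 𝟙 (gcdSet A ≟ 1)     ≡⟨ 1≢0 (gcdSet A) ⟩
         𝟙 (gcdSet A ≟ 1)                               ∎) ⟩
  sumOver (subsets m) (λ A → 𝟙 (gcdSet A ≟ 1))
    ≡⟨ sumOver-gcdSet m (λ x → 𝟙 (x ≟ 1)) ⟩
  gcdSum m (λ x → 𝟙 (x ≟ 1)) ∎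
  where
  1≢0 : ∀ x → 𝟙 (¬? (x ≟ 0)) ℤ.* 𝟙 (x ≟ 1) ≡ 𝟙 (x ≟ 1)
  1≢0 zero    = refl
  1≢0 (suc x) = ℤ.*-identityˡ _

-- Made total so that it can be summed over g; n div 0 = 0 is a junk value.
infixl 7 _div_
_div_ : ℕ → ℕ → ℕ
n div zero  = 0
n div suc g = n / suc g

M̄≡Sum : ∀ n → + M̄ n ≡ Sum n (λ g → (𝟙 (gcd g n ≟ 1) ℤ.* + gcd (g ∸ 1) n) ℤ.* + f (n div g))
M̄≡Sum n = begin
  + M̄ n
    ≡⟨ sum-map-filter (λ A → nonempty? A ×-dec gcd (gcdSet A) n ≟ 1) (λ A → gcd (gcdSet A ∸ 1) n) (subsets n) ⟩
  sumOver (subsets n) (λ A → 𝟙 (nonempty? A ×-dec gcd (gcdSet A) n ≟ 1) ℤ.* + gcd (gcdSet A ∸ 1) n)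
    ≡⟨ sumOver-cong (subsets n) (λ A → cong (ℤ._* + gcd (gcdSet A ∸ 1) n) (trans
         (𝟙-× (nonempty? A) (gcd (gcdSet A) n ≟ 1))
         (cong (ℤ._* 𝟙 (gcd (gcdSet A) n ≟ 1)) (𝟙-nonempty A)))) ⟩
  sumOver (subsets n) (weight ∘ gcdSet)
    ≡⟨ sumOver-gcdSet n weight ⟩
  gcdSum n weight
    -- The factor that came from nonemptiness makes `weight 0` compute to zero.
    ≡⟨ gcdSum-partition n weight refl ⟩
  Sum n (λ g → weight g ℤ.* gcdSum n (λ x → 𝟙 (x ≟ g)))
    ≡⟨ Sum-cong n (λ { g@(suc _) _ → cong₂ ℤ._*_
         (cong (ℤ._* + gcd (g ∸ 1) n) (ℤ.*-identityˡ (𝟙 (gcd g n ≟ 1))))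
         (trans (gcdSum-𝟙 g n) (sym (f≡gcdSum (n / g)))) }) ⟩
  Sum n (λ g → (𝟙 (gcd g n ≟ 1) ℤ.* + gcd (g ∸ 1) n) ℤ.* + f (n div g)) ∎
  where
  weight : ℕ → ℤ
  weight x = (𝟙 (¬? (x ≟ 0)) ℤ.* 𝟙 (gcd x n ≟ 1)) ℤ.* + gcd (x ∸ 1) n

-- Divisor sums of φ and μ

φ≡Sum : ∀ d → + φ d ≡ Sum d (λ k → 𝟙 (gcd k d ≟ 1))
φ≡Sum d = count-[1⋯] (λ k → gcd k d ≟ 1) d

Sum-1 : ∀ n → Sum n (λ _ → 1ℤ) ≡ + n
Sum-1 zero    = refl
Sum-1 (suc n) = trans (cong (ℤ._+ 1ℤ) (Sum-1 n)) (cong +_ (+-comm n 1))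

factors-nonZero : ∀ {m a b} → .{{NonZero m}} → m ≡ a * b → NonZero a × NonZero b
factors-nonZero {a = a} {b} refl = m*n≢0⇒m≢0 a , m*n≢0⇒n≢0 a

-- The k ≤ m with gcd k m = m / d are the multiples (m / d) j with j ≤ d prime to d.
φ-counts-gcd : ∀ m d → .{{_ : NonZero m}} →
               𝟙 (d ∣? m) ℤ.* + φ d ≡ Sum m (λ k → 𝟙 (m ≟ gcd k m * d))
φ-counts-gcd m d with d ∣? m
-- Written as a product, the equation has no solution k unless d divides m, so both sides vanish
-- here.
... | no d∤m = sym (Sum-zero m λ k _ → 𝟙-false (m ≟ gcd k m * d) λ eq → d∤m (divides (gcd k m) eq))
... | yes (divides e eq) with factors-nonZero {a = e} eq
...   | e≢0 , d≢0 = begin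
  1ℤ ℤ.* + φ d
    ≡⟨ trans (ℤ.*-identityˡ _) (φ≡Sum d) ⟩
  Sum d (λ j → 𝟙 (gcd j d ≟ 1))
    ≡⟨ Sum-cong d (λ j _ → 𝟙-cong (gcd j d ≟ 1) (m ≟ gcd (e * j) m * d)
         (λ g≡1 → begin
           m                    ≡⟨ eq ⟩
           e * d                ≡⟨ cong (_* d) (*-identityʳ e) ⟨
           e * 1 * d            ≡⟨ cong (λ g → e * g * d) g≡1 ⟨
           e * gcd j d * d      ≡⟨ cong (_* d) (gcd-ej j) ⟨
           gcd (e * j) m * d    ∎)
         (λ m≡ → *-cancelˡ-≡ (gcd j d) 1 e (begin
           e * gcd j d          ≡⟨ gcd-ej j ⟨
           gcd (e * j) m        ≡⟨ *-cancelʳ-≡ _ _ d (trans (sym m≡) eq) ⟩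
           e                    ≡⟨ *-identityʳ e ⟨
           e * 1                ∎))) ⟩
  Sum d (λ j → 𝟙 (m ≟ gcd (e * j) m * d))
    ≡⟨ cong (λ q → Sum q (λ j → 𝟙 (m ≟ gcd (e * j) m * d))) m/e≡d ⟨
  Sum (m / e) (λ j → 𝟙 (m ≟ gcd (e * j) m * d))
    ≡⟨ Sum-multiples e m (λ k e∤k → 𝟙-false (m ≟ gcd k m * d) λ m≡ →
         e∤k (subst (_∣ k) (*-cancelʳ-≡ _ _ d (trans (sym m≡) eq)) (gcd[m,n]∣m k m))) ⟨
  Sum m (λ k → 𝟙 (m ≟ gcd k m * d)) ∎
  where
  instance
    _ = e≢0
    _ = d≢0
  gcd-ej : ∀ j → gcd (e * j) m ≡ e * gcd j d
  gcd-ej j = trans (cong (gcd (e * j)) eq) (sym (c*gcd[m,n]≡gcd[cm,cn] e j d))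
  m/e≡d : m / e ≡ d
  m/e≡d = trans (cong (_/ e) (trans eq (*-comm e d))) (m*n/n≡m d e)

-- Gauss's count: each k ≤ m is counted at exactly one d, the codivisor of gcd k m in m.
φ-divisor-sum : ∀ m → .{{_ : NonZero m}} → Sum m (λ d → 𝟙 (d ∣? m) ℤ.* + φ d) ≡ + m
φ-divisor-sum m = begin
  Sum m (λ d → 𝟙 (d ∣? m) ℤ.* + φ d)
    ≡⟨ Sum-cong m (λ d _ → φ-counts-gcd m d) ⟩
  Sum m (λ d → Sum m (λ k → 𝟙 (m ≟ gcd k m * d)))
    ≡⟨ Sum-swap m m (λ d k → 𝟙 (m ≟ gcd k m * d)) ⟩
  Sum m (λ k → Sum m (λ d → 𝟙 (m ≟ gcd k m * d)))
    ≡⟨ Sum-cong m (λ k _ → codivisor-unique (gcd k m) (gcd[m,n]∣n k m)) ⟩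
  Sum m (λ _ → 1ℤ)
    ≡⟨ Sum-1 m ⟩
  + m ∎
  where
  codivisor-unique : ∀ g → g ∣ m → Sum m (λ d → 𝟙 (m ≟ g * d)) ≡ 1ℤ
  codivisor-unique g (divides q eq) with factors-nonZero {a = q} eq
  ... | q≢0 , g≢0 = trans
    (Sum-cong m λ d _ → trans
      (𝟙-cong (m ≟ g * d) (q ≟ d)
        (λ m≡ → *-cancelˡ-≡ q d g (trans (*-comm g q) (trans (sym eq) m≡)))
        (λ q≡d → trans eq (trans (*-comm q g) (cong (g *_) q≡d))))
      (sym (ℤ.*-identityʳ _)))
    (Sum-δ m q (∣⇒≤ (divides g (trans eq (*-comm q g)))) (λ _ → 1ℤ))
    where
    instance
      _ = q≢0
      _ = g≢0

-- Prime divisors and the divisor sum of the Möbius function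

prime-divisor : ∀ n → .{{NonTrivial n}} → ∃ λ p → Prime p × p ∣ n
prime-divisor n with factorise n {{nonTrivial⇒nonZero n}}
... | record { factors = [] ; isFactorisation = n≡1 } = contradiction n≡1 nonTrivial⇒≢1
... | record { factors = p ∷ ps ; isFactorisation = eq ; factorsPrime = pp ∷ _ } =
  p , pp , subst (p ∣_) (sym eq) (m∣m*n (product ps))

HasPrimeSquare : ℕ → Set
HasPrimeSquare n = Any (λ p → p * p ∣ n) (primeDivisors n)

hasPrimeSquare? : ∀ n → Dec (HasPrimeSquare n)
hasPrimeSquare? n = any? (λ p → p * p ∣? n) (primeDivisors n)

∈-[1⋯] : ∀ {k n} → .{{NonZero k}} → k ≤ n → k ∈ [1⋯ n ]
∈-[1⋯] {suc k} k<n = ∈-map⁺ suc (∈-upTo⁺ k<n)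

hasPrimeSquare : ∀ {n p} → .{{NonZero n}} → Prime p → p * p ∣ n → HasPrimeSquare n
hasPrimeSquare {n} {p} pp pp∣n = lose (∈-filter⁺ (λ q → prime? q ×-dec q ∣? n) (∈-[1⋯] (∣⇒≤ p∣n)) (pp , p∣n)) pp∣n
  where
  instance _ = prime⇒nonZero pp
  p∣n : p ∣ n
  p∣n = ∣-trans (m∣m*n p) pp∣n

primeSquare : ∀ {n} → HasPrimeSquare n → ∃ λ p → Prime p × p * p ∣ n
primeSquare {n} h with find h
... | p , p∈ , pp∣n = p , proj₁ (proj₂ (∈-filter⁻ (λ q → prime? q ×-dec q ∣? n) {xs = [1⋯ n ]} p∈)) , pp∣n

prime∣prime : ∀ {p q} → Prime p → Prime q → p ∣ q → p ≡ q
prime∣prime pp pq p∣q with prime⇒irreducible pq p∣q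
... | inj₁ refl = contradiction pp ¬prime[1]
... | inj₂ p≡q  = p≡q

-- If q = p, cancelling p would give p ∣ k; otherwise q² is coprime to p. So a new prime factor
-- creates no new prime square.
prime²∣prime*k : ∀ {p q k} → Prime p → p ∤ k → Prime q → q * q ∣ p * k → q * q ∣ k
prime²∣prime*k {p} {q} {k} pp p∤k pq qq∣pk with q ≟ p
... | yes refl = contradiction (*-cancelˡ-∣ p {{prime⇒nonZero pp}} qq∣pk) p∤k
... | no  q≢p  = coprime-divisor q²-p-coprime qq∣pk
  where
  q²-p-coprime : Coprime (q * q) p
  q²-p-coprime (d∣qq , d∣p) with prime⇒irreducible pp d∣p
  ... | inj₁ d≡1  = d≡1
  ... | inj₂ refl = contradiction
    (sym (prime∣prime pp pq ([ id , id ]′ (euclidsLemma q q pp d∣qq)))) q≢p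

length-primeDivisors : ∀ p k → .{{_ : NonZero k}} → Prime p → p ∤ k →
                       length (primeDivisors (p * k)) ≡ suc (length (primeDivisors k))
length-primeDivisors p k pp p∤k = ℤ.+-injective (begin
  + length (primeDivisors (p * k))
    ≡⟨ count-[1⋯] (isPrimeDivisor? (p * k)) (p * k) ⟩
  Sum (p * k) (λ q → 𝟙 (isPrimeDivisor? (p * k) q))
    ≡⟨ Sum-cong (p * k) (λ q _ → split q) ⟩
  -- The factor `1ℤ` gives the indicator the shape that `Sum-δ` collapses.
  Sum (p * k) (λ q → 𝟙 (p ≟ q) ℤ.* 1ℤ ℤ.+ 𝟙 (isPrimeDivisor? k q))
    ≡⟨ Sum-+ (p * k) (λ q → 𝟙 (p ≟ q) ℤ.* 1ℤ) (λ q → 𝟙 (isPrimeDivisor? k q)) ⟩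
  Sum (p * k) (λ q → 𝟙 (p ≟ q) ℤ.* 1ℤ) ℤ.+ Sum (p * k) (λ q → 𝟙 (isPrimeDivisor? k q))
    ≡⟨ cong₂ ℤ._+_
         (Sum-δ (p * k) p (∣⇒≤ (m∣m*n k)) (λ _ → 1ℤ))
         (Sum-truncate (∣⇒≤ (n∣m*n p)) λ q k<q →
           𝟙-false (isPrimeDivisor? k q) λ (_ , q∣k) → >⇒∤ k<q q∣k) ⟩
  1ℤ ℤ.+ Sum k (λ q → 𝟙 (isPrimeDivisor? k q))
    ≡⟨ cong (ℤ._+_ 1ℤ) (count-[1⋯] (isPrimeDivisor? k) k) ⟨
  + suc (length (primeDivisors k)) ∎)
  where
  instance
    _ = prime⇒nonZero pp
    _ = m*n≢0 p k {{prime⇒nonZero pp}}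
  isPrimeDivisor? : ∀ n q → Dec (Prime q × q ∣ n)
  isPrimeDivisor? n q = prime? q ×-dec q ∣? n
  split : ∀ q → 𝟙 (isPrimeDivisor? (p * k) q) ≡ 𝟙 (p ≟ q) ℤ.* 1ℤ ℤ.+ 𝟙 (isPrimeDivisor? k q)
  split q = trans (byCases (p ≟ q)) (cong (ℤ._+ _) (sym (ℤ.*-identityʳ (𝟙 (p ≟ q)))))
    where
    byCases : (p≟q : Dec (p ≡ q)) → 𝟙 (isPrimeDivisor? (p * k) q) ≡ 𝟙 p≟q ℤ.+ 𝟙 (isPrimeDivisor? k q)
    byCases (yes refl) = trans
      (𝟙-true (isPrimeDivisor? (p * k) p) (pp , m∣m*n k))
      (cong (ℤ._+_ 1ℤ) (sym (𝟙-false (isPrimeDivisor? k p) λ (_ , p∣k) → p∤k p∣k)))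
    byCases (no p≢q) = trans
      (𝟙-cong (isPrimeDivisor? (p * k) q) (isPrimeDivisor? k q)
        (λ (pq , q∣pk) → pq , [ (λ q∣p → contradiction (sym (prime∣prime pq pp q∣p)) p≢q) , id ]′
                                (euclidsLemma p k pq q∣pk))
        (λ (pq , q∣k) → pq , ∣n⇒∣m*n p q∣k))
      (sym (ℤ.+-identityˡ _))

-- If p ∣ k, then p² ∣ p k. If not, the prime squares are those of k and there is one more prime
-- divisor, which flips the sign.
μ-prime-* : ∀ p k → .{{_ : NonZero k}} → Prime p → μ (p * k) ≡ ℤ.- (𝟙 (¬? (p ∣? k)) ℤ.* μ k)
μ-prime-* p k pp with p ∣? k
... | yes p∣k = cong (if_then 0ℤ else (-1ℤ ℤ.^ length (primeDivisors (p * k))))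
  (dec-true (hasPrimeSquare? (p * k)) (hasPrimeSquare {{m*n≢0 p k {{prime⇒nonZero pp}}}} pp (*-monoʳ-∣ p p∣k)))
... | no p∤k = begin
  (if does (hasPrimeSquare? (p * k)) then 0ℤ else (-1ℤ ℤ.^ length (primeDivisors (p * k))))
    ≡⟨ cong₂ (if_then 0ℤ else_)
         (does-⇔ (mk⇔ to from) (hasPrimeSquare? (p * k)) (hasPrimeSquare? k))
         (cong (-1ℤ ℤ.^_) (length-primeDivisors p k pp p∤k)) ⟩
  (if does (hasPrimeSquare? k) then 0ℤ else (-1ℤ ℤ.* -1ℤ ℤ.^ length (primeDivisors k)))
    ≡⟨ if-neg (does (hasPrimeSquare? k)) (-1ℤ ℤ.^ length (primeDivisors k)) ⟩
  ℤ.- μ k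
    ≡⟨ cong ℤ.-_ (ℤ.*-identityˡ (μ k)) ⟨
  ℤ.- (1ℤ ℤ.* μ k) ∎
  where
  to : HasPrimeSquare (p * k) → HasPrimeSquare k
  to h with primeSquare h
  ... | q , pq , qq∣pk = hasPrimeSquare pq (prime²∣prime*k pp p∤k pq qq∣pk)
  from : HasPrimeSquare k → HasPrimeSquare (p * k)
  from h with primeSquare h
  ... | q , pq , qq∣k = hasPrimeSquare {{m*n≢0 p k {{prime⇒nonZero pp}}}} pq (∣n⇒∣m*n p qq∣k)
  if-neg : ∀ b x → (if b then 0ℤ else (-1ℤ ℤ.* x)) ≡ ℤ.- (if b then 0ℤ else x)
  if-neg true  x = refl
  if-neg false x = ℤ.-1*i≡-i x

-- For a prime p dividing m, the terms of δ and p δ cancel when p ∤ δ, and μ (p δ) = 0 when p ∣ δ.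
μ-divisor-sum-prime : ∀ m p → .{{_ : NonZero m}} → Prime p → p ∣ m → Sum m (λ δ → 𝟙 (δ ∣? m) ℤ.* μ δ) ≡ 0ℤ
μ-divisor-sum-prime m p pp (divides m′ eq) = begin
  Sum m (λ δ → 𝟙 (δ ∣? m) ℤ.* μ δ)
    ≡⟨ Sum-cong m (λ δ _ → split δ (p ∣? δ)) ⟩
  Sum m (λ δ → H δ ℤ.+ G′ δ)
    ≡⟨ Sum-+ m H G′ ⟩
  Sum m H ℤ.+ Sum m G′
    ≡⟨ cong₂ ℤ._+_
         (Sum-multiples p m λ δ p∤δ → cong (ℤ._* (𝟙 (δ ∣? m) ℤ.* μ δ)) (𝟙-false (p ∣? δ) p∤δ))
         (Sum-truncate m′≤m λ δ m′<δ → trans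
           (cong (λ x → 𝟙 (¬? (p ∣? δ)) ℤ.* (x ℤ.* μ δ)) (𝟙-false (δ ∣? m′) (>⇒∤ m′<δ)))
           (ℤ.*-zeroʳ (𝟙 (¬? (p ∣? δ))))) ⟩
  Sum (m / p) (λ j → H (p * j)) ℤ.+ Sum m′ G′
    ≡⟨ cong (λ q → Sum q (λ j → H (p * j)) ℤ.+ Sum m′ G′) (trans (cong (_/ p) eq) (m*n/n≡m m′ p)) ⟩
  Sum m′ (λ j → H (p * j)) ℤ.+ Sum m′ G′
    ≡⟨ Sum-+ m′ (λ j → H (p * j)) G′ ⟨
  Sum m′ (λ j → H (p * j) ℤ.+ G′ j)
    ≡⟨ Sum-zero m′ (λ j _ → cancel j) ⟩
  0ℤ ∎
  where
  instance
    _ = prime⇒nonZero pp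
    _ = proj₁ (factors-nonZero {a = m′} eq)
  m′≤m : m′ ≤ m
  m′≤m = ∣⇒≤ (divides p (trans eq (*-comm m′ p)))
  -- `H` keeps the divisors that are multiples of p, `G′` the others. For the latter, dividing m is
  -- the same as dividing m′ = m / p, so after δ = p j in `H` both sums run over j ≤ m′ and cancel
  -- term by term.
  H G′ : ℕ → ℤ
  H δ  = 𝟙 (p ∣? δ) ℤ.* (𝟙 (δ ∣? m) ℤ.* μ δ)
  G′ δ = 𝟙 (¬? (p ∣? δ)) ℤ.* (𝟙 (δ ∣? m′) ℤ.* μ δ)
  split : ∀ δ → (d : Dec (p ∣ δ)) →
          𝟙 (δ ∣? m) ℤ.* μ δ ≡ 𝟙 d ℤ.* (𝟙 (δ ∣? m) ℤ.* μ δ) ℤ.+ 𝟙 (¬? d) ℤ.* (𝟙 (δ ∣? m′) ℤ.* μ δ)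
  split δ (yes _)   = sym (trans (ℤ.+-identityʳ _) (ℤ.*-identityˡ _))
  split δ (no p∤δ) = sym (trans (ℤ.+-identityˡ _) (trans (ℤ.*-identityˡ _) (cong (ℤ._* μ δ)
    (𝟙-cong (δ ∣? m′) (δ ∣? m)
      (λ δ∣m′ → subst (δ ∣_) (sym eq) (∣m⇒∣m*n p δ∣m′))
      (λ δ∣m → coprime-divisor δ-p-coprime (subst (δ ∣_) (trans eq (*-comm m′ p)) δ∣m))))))
    where
    δ-p-coprime : Coprime δ p
    δ-p-coprime (d∣δ , d∣p) with prime⇒irreducible pp d∣p
    ... | inj₁ d≡1  = d≡1
    ... | inj₂ refl = contradiction d∣δ p∤δ
  cancelling : ∀ a b c → 1ℤ ℤ.* (b ℤ.* (ℤ.- (a ℤ.* c))) ℤ.+ a ℤ.* (b ℤ.* c) ≡ 0ℤ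
  cancelling = solve-∀
  cancel : ∀ j → .{{NonZero j}} → H (p * j) ℤ.+ G′ j ≡ 0ℤ
  cancel j = begin
    H (p * j) ℤ.+ G′ j
      ≡⟨ cong (ℤ._+ G′ j) (cong₂ ℤ._*_ (𝟙-true (p ∣? p * j) (m∣m*n j)) (cong₂ ℤ._*_
           (𝟙-cong (p * j ∣? m) (j ∣? m′)
             (λ pj∣m → *-cancelˡ-∣ p (subst (p * j ∣_) (trans eq (*-comm m′ p)) pj∣m))
             (λ j∣m′ → subst (p * j ∣_) (sym (trans eq (*-comm m′ p))) (*-monoʳ-∣ p j∣m′)))
           (μ-prime-* p j pp))) ⟩
    1ℤ ℤ.* (𝟙 (j ∣? m′) ℤ.* (ℤ.- (𝟙 (¬? (p ∣? j)) ℤ.* μ j))) ℤ.+ G′ j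
      ≡⟨ cancelling (𝟙 (¬? (p ∣? j))) (𝟙 (j ∣? m′)) (μ j) ⟩
    0ℤ ∎

μ-divisor-sum : ∀ m → .{{_ : NonZero m}} → Sum m (λ δ → 𝟙 (δ ∣? m) ℤ.* μ δ) ≡ 𝟙 (m ≟ 1)
μ-divisor-sum 1 = refl
μ-divisor-sum m@(2+ _) with prime-divisor m
... | p , pp , p∣m = μ-divisor-sum-prime m p pp p∣m

-- The range shrinks to gcd a n to fit the divisor sums of `φ` and `μ`. The case a = 0, which occurs
-- as g - 1 at g = 1, is covered: every d divides 0 and gcd 0 n is n.
Sum-common-divisors : ∀ a n → .{{_ : NonZero n}} → (H : ℕ → ℤ) →
  Sum n (λ d → (𝟙 (d ∣? n) ℤ.* 𝟙 (d ∣? a)) ℤ.* H d) ≡ Sum (gcd a n) (λ d → 𝟙 (d ∣? gcd a n) ℤ.* H d)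
Sum-common-divisors a n H = trans
  (Sum-cong n λ d _ → cong (ℤ._* H d) (trans
    (sym (𝟙-× (d ∣? n) (d ∣? a)))
    (𝟙-cong (d ∣? n ×-dec d ∣? a) (d ∣? gcd a n)
      (λ (d∣n , d∣a) → gcd-greatest d∣a d∣n)
      (λ d∣gcd → ∣-trans d∣gcd (gcd[m,n]∣n a n) , ∣-trans d∣gcd (gcd[m,n]∣m a n)))))
  (Sum-truncate (gcd[m,n]≤n a n) λ d gcd<d → cong (ℤ._* H d) (𝟙-false (d ∣? gcd a n) (>⇒∤ gcd<d)))
  where instance _ = gcd-nonZero a n

-- Expansion of the gcd factors and exchange of the sums

mainTheorem1 : (n : ℕ) → .{{_ : NonZero n}} →
    + M̄ n ≡
    ∑ n (λ d → d ∣? n) (λ d →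
    + φ d ℤ.* ∑ n (λ δ → δ ∣? n ×-dec gcd δ d ≟ 1) (λ δ →
    μ δ ℤ.* ∑ (n / δ) (λ j → δ * j ≡? 1 [mod d ]) (λ j →
    + f (_/_ n (j * δ) {{m*n≢0 j δ}}))))
mainTheorem1 n = sym (begin
  ∑ n (λ d → d ∣? n) (λ d →
    + φ d ℤ.* ∑ n (λ δ → δ ∣? n ×-dec gcd δ d ≟ 1) (λ δ →
    μ δ ℤ.* ∑ (n / δ) (λ j → δ * j ≡? 1 [mod d ]) (λ j →
    + f (_/_ n (j * δ) {{m*n≢0 j δ}}))))
    ≡⟨ ∑≡Sum n _ _ (λ d → Sum n λ δ → Sum n λ g → term d δ g) (λ d _ → begin
         𝟙 (d ∣? n) ℤ.* (+ φ d ℤ.* _)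
           ≡⟨ cong (λ x → 𝟙 (d ∣? n) ℤ.* (+ φ d ℤ.* x)) (∑≡Sum n _ _ _ λ δ _ → middle d δ) ⟩
         𝟙 (d ∣? n) ℤ.* (+ φ d ℤ.* Sum n (λ δ → Sum n (inner d δ)))
           ≡⟨ outer d ⟩
         Sum n (λ δ → Sum n λ g → term d δ g) ∎) ⟩
  Sum n (λ d → Sum n λ δ → Sum n λ g → term d δ g)
    ≡⟨ Sum-cong n (λ d _ → Sum-swap n n (term d)) ⟩
  Sum n (λ d → Sum n λ g → Sum n λ δ → term d δ g)
    ≡⟨ Sum-swap n n (λ d g → Sum n λ δ → term d δ g) ⟩
  Sum n (λ g → Sum n λ d → Sum n λ δ → term d δ g)
    ≡⟨ Sum-cong n (λ g _ → factorised g) ⟩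
  Sum n (λ g → (𝟙 (gcd g n ≟ 1) ℤ.* + gcd (g ∸ 1) n) ℤ.* + f (n div g))
    ≡⟨ M̄≡Sum n ⟨
  + M̄ n ∎)
  where
  -- For fixed g, `a` depends only on d and `b` only on δ, so the double sum of `term` factors into
  -- a totient sum and a Möbius sum.
  a b : ℕ → ℕ → ℤ
  a d g = (𝟙 (d ∣? n) ℤ.* 𝟙 (d ∣? (g ∸ 1))) ℤ.* + φ d
  b δ g = (𝟙 (δ ∣? n) ℤ.* 𝟙 (δ ∣? g)) ℤ.* μ δ

  term inner : ℕ → ℕ → ℕ → ℤ
  term d δ g = a d g ℤ.* (b δ g ℤ.* + f (n div g))
  inner d δ g = 𝟙 (d ∣? (g ∸ 1)) ℤ.* (b δ g ℤ.* + f (n div g))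

  Sum-a : ∀ g → Sum n (λ d → a d g) ≡ + gcd (g ∸ 1) n
  Sum-a g = trans (Sum-common-divisors (g ∸ 1) n (λ d → + φ d)) (φ-divisor-sum (gcd (g ∸ 1) n) {{gcd-nonZero (g ∸ 1) n}})

  Sum-b : ∀ g → Sum n (λ δ → b δ g) ≡ 𝟙 (gcd g n ≟ 1)
  Sum-b g = trans (Sum-common-divisors g n μ) (μ-divisor-sum (gcd g n) {{gcd-nonZero g n}})

  factorised : ∀ g → Sum n (λ d → Sum n λ δ → term d δ g) ≡
                     (𝟙 (gcd g n ≟ 1) ℤ.* + gcd (g ∸ 1) n) ℤ.* + f (n div g)
  factorised g = begin
    Sum n (λ d → Sum n λ δ → a d g ℤ.* (b δ g ℤ.* c))
      ≡⟨ Sum-cong n (λ d _ → trans (Sum-*ˡ n (a d g) (λ δ → b δ g ℤ.* c)) (cong (a d g ℤ.*_) (Sum-*ʳ n c (λ δ → b δ g)))) ⟩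
    Sum n (λ d → a d g ℤ.* (Sum n (λ δ → b δ g) ℤ.* c))
      ≡⟨ Sum-*ʳ n (Sum n (λ δ → b δ g) ℤ.* c) (λ d → a d g) ⟩
    Sum n (λ d → a d g) ℤ.* (Sum n (λ δ → b δ g) ℤ.* c)
      ≡⟨ cong₂ (λ x y → x ℤ.* (y ℤ.* c)) (Sum-a g) (Sum-b g) ⟩
    + gcd (g ∸ 1) n ℤ.* (𝟙 (gcd g n ≟ 1) ℤ.* c)
      ≡⟨ rearrange (+ gcd (g ∸ 1) n) (𝟙 (gcd g n ≟ 1)) c ⟩
    (𝟙 (gcd g n ≟ 1) ℤ.* + gcd (g ∸ 1) n) ℤ.* c ∎
    where
    c : ℤ
    c = + f (n div g)
    rearrange : ∀ x y z → x ℤ.* (y ℤ.* z) ≡ (y ℤ.* x) ℤ.* z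
    rearrange = solve-∀

  outer : ∀ d → 𝟙 (d ∣? n) ℤ.* (+ φ d ℤ.* Sum n (λ δ → Sum n (inner d δ))) ≡ Sum n (λ δ → Sum n (term d δ))
  outer d = begin
    𝟙 (d ∣? n) ℤ.* (+ φ d ℤ.* Sum n (λ δ → Sum n (inner d δ)))
      ≡⟨ ℤ.*-assoc (𝟙 (d ∣? n)) (+ φ d) _ ⟨
    c ℤ.* Sum n (λ δ → Sum n (inner d δ))
      ≡⟨ Sum-*ˡ n c (λ δ → Sum n (inner d δ)) ⟨
    Sum n (λ δ → c ℤ.* Sum n (inner d δ))
      ≡⟨ Sum-cong n (λ δ _ → trans (sym (Sum-*ˡ n c (inner d δ)))
           (Sum-cong n λ g _ → rearrange (𝟙 (d ∣? n)) (+ φ d) (𝟙 (d ∣? (g ∸ 1))) (b δ g ℤ.* + f (n div g)))) ⟩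
    Sum n (λ δ → Sum n (term d δ)) ∎
    where
    c : ℤ
    c = 𝟙 (d ∣? n) ℤ.* + φ d
    rearrange : ∀ x y z w → (x ℤ.* y) ℤ.* (z ℤ.* w) ≡ ((x ℤ.* z) ℤ.* y) ℤ.* w
    rearrange = solve-∀

  -- A common divisor of δ and d divides the consecutive integers g - 1 and g.
  coprime-redundant : ∀ {d δ g} → .{{NonZero g}} → δ ∣ g → d ∣ g ∸ 1 → gcd δ d ≡ 1
  coprime-redundant {d} {δ} {suc g} δ∣1+g d∣g = coprime⇒gcd≡1 λ {e} (e∣δ , e∣d) →
    ∣1⇒≡1 (∣m+n∣m⇒∣n (subst (e ∣_) (+-comm 1 g) (∣-trans e∣δ δ∣1+g)) (∣-trans e∣d d∣g))

  congruence : ∀ d g → .{{NonZero g}} → 𝟙 (g ≡? 1 [mod d ]) ≡ 𝟙 (d ∣? (g ∸ 1))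
  congruence d (suc g) = cong (λ x → 𝟙 (d ∣? x)) (∣-∣-identityʳ g)

  div-cong : ∀ δ j → .{{_ : NonZero δ}} → .{{_ : NonZero j}} → _/_ n (j * δ) {{m*n≢0 j δ}} ≡ n div (δ * j)
  div-cong δ@(suc _) j@(suc _) = cong (n div_) (*-comm j δ)

  middle : ∀ d δ → .{{_ : NonZero δ}} →
    𝟙 (δ ∣? n ×-dec gcd δ d ≟ 1) ℤ.* (μ δ ℤ.* ∑ (n / δ) (λ j → δ * j ≡? 1 [mod d ]) (λ j →
      + f (_/_ n (j * δ) {{m*n≢0 j δ}}))) ≡ Sum n (inner d δ)
  middle d δ = begin
    𝟙 (δ ∣? n ×-dec gcd δ d ≟ 1) ℤ.* (μ δ ℤ.* _)
      ≡⟨ cong (λ x → 𝟙 (δ ∣? n ×-dec gcd δ d ≟ 1) ℤ.* (μ δ ℤ.* x)) (begin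
           ∑ (n / δ) (λ j → δ * j ≡? 1 [mod d ]) (λ j → + f (_/_ n (j * δ) {{m*n≢0 j δ}}))
             ≡⟨ ∑≡Sum (n / δ) _ _ (λ j → multiple (δ * j)) (λ j _ → atMultiple j) ⟩
           Sum (n / δ) (λ j → multiple (δ * j))
             -- The substitution g = δ j, read backwards: j ≤ n / δ becomes g ≤ n with an indicator
             -- of δ ∣ g.
             ≡⟨ Sum-multiples δ n (λ g δ∤g → cong (ℤ._* (𝟙 (d ∣? (g ∸ 1)) ℤ.* + f (n div g))) (𝟙-false (δ ∣? g) δ∤g)) ⟨
           Sum n multiple ∎) ⟩
    𝟙 (δ ∣? n ×-dec gcd δ d ≟ 1) ℤ.* (μ δ ℤ.* Sum n multiple)
      ≡⟨ cong (ℤ._* (μ δ ℤ.* Sum n multiple)) (𝟙-× (δ ∣? n) (gcd δ d ≟ 1)) ⟩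
    (𝟙 (δ ∣? n) ℤ.* 𝟙 (gcd δ d ≟ 1)) ℤ.* (μ δ ℤ.* Sum n multiple)
      ≡⟨ ℤ.*-assoc (𝟙 (δ ∣? n) ℤ.* 𝟙 (gcd δ d ≟ 1)) (μ δ) (Sum n multiple) ⟨
    c ℤ.* Sum n multiple
      ≡⟨ Sum-*ˡ n c multiple ⟨
    Sum n (λ g → c ℤ.* multiple g)
      ≡⟨ Sum-cong n (λ g _ → begin
           c ℤ.* multiple g
             -- The indicators of d ∣ g - 1 and δ ∣ g move to the front, so that both facts are at
             -- hand when the coprimality indicator is replaced by 1.
             ≡⟨ rearrange (𝟙 (δ ∣? n)) (𝟙 (gcd δ d ≟ 1)) (μ δ) (𝟙 (δ ∣? g)) (𝟙 (d ∣? (g ∸ 1))) (+ f (n div g)) ⟩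
           𝟙 (d ∣? (g ∸ 1)) ℤ.* (𝟙 (δ ∣? g) ℤ.* (𝟙 (gcd δ d ≟ 1) ℤ.* ((𝟙 (δ ∣? n) ℤ.* μ δ) ℤ.* + f (n div g))))
             ≡⟨ 𝟙-*-cong (d ∣? (g ∸ 1)) (λ d∣ → 𝟙-*-cong (δ ∣? g) (λ δ∣ →
                  𝟙-*-true (gcd δ d ≟ 1) (coprime-redundant δ∣ d∣))) ⟩
           𝟙 (d ∣? (g ∸ 1)) ℤ.* (𝟙 (δ ∣? g) ℤ.* ((𝟙 (δ ∣? n) ℤ.* μ δ) ℤ.* + f (n div g)))
             ≡⟨ rearrange′ (𝟙 (δ ∣? n)) (μ δ) (𝟙 (δ ∣? g)) (𝟙 (d ∣? (g ∸ 1))) (+ f (n div g)) ⟩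
           inner d δ g ∎) ⟩
    Sum n (inner d δ) ∎
    where
    c : ℤ
    c = (𝟙 (δ ∣? n) ℤ.* 𝟙 (gcd δ d ≟ 1)) ℤ.* μ δ
    multiple : ℕ → ℤ
    multiple g = 𝟙 (δ ∣? g) ℤ.* (𝟙 (d ∣? (g ∸ 1)) ℤ.* + f (n div g))
    atMultiple : ∀ j → .{{_ : NonZero j}} →
      𝟙 (δ * j ≡? 1 [mod d ]) ℤ.* + f (_/_ n (j * δ) {{m*n≢0 j δ}}) ≡ multiple (δ * j)
    atMultiple j = trans
      (cong₂ (λ x y → x ℤ.* + f y) (congruence d (δ * j) {{m*n≢0 δ j}}) (div-cong δ j))
      (sym (𝟙-*-true (δ ∣? δ * j) (m∣m*n j)))
    rearrange : ∀ p q m r s t →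
      ((p ℤ.* q) ℤ.* m) ℤ.* (r ℤ.* (s ℤ.* t)) ≡ s ℤ.* (r ℤ.* (q ℤ.* ((p ℤ.* m) ℤ.* t)))
    rearrange = solve-∀
    rearrange′ : ∀ p m r s t → s ℤ.* (r ℤ.* ((p ℤ.* m) ℤ.* t)) ≡ s ℤ.* (((p ℤ.* r) ℤ.* m) ℤ.* t)
    rearrange′ = solve-∀
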